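{- For every integer $n\ge 0$, $$C_{n+1}C_{n+2}=\sum_{k=0}^{n}\frac{(2k+2)(2k+4)(8nk+6n+14k+12)}{(2n+2)(2n+3)(2n+4)(2n+5)(2n+6)}\binom{2n+3}{n-k}\binom{2n+6}{n-k+2},$$ $$C_{n+1}^2=\sum_{k=0}^{n}\frac{(2k+2)(2k+3)(2k+4)}{(2n+2)(2n+3)(2n+4)^2}\binom{2n+4}{n-k}\binom{2n+4}{n-k+1},$$ $$C_{n+1}C_{n+2}=\sum_{k=0}^{n}\frac{(2k+2)(2k+4)(8nk+18n+14k+30)}{(2n+2)(2n+3)(2n+4)(2n+5)(2n+6)}\binom{2n+3}{n-k}\binom{2n+6}{n-k+1}.$$
   Context: $C_n=\frac{1}{n+1}\binom{2n}{n}$ is the $n$-th Catalan number. -}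

module Defs where

open import Data.Fin.Base using (toℕ)
open import Data.Integer.Base using (+_)
open import Data.Nat.Base using (ℕ; suc; _*_)
open import Data.Nat.Combinatorics using (_C_)
open import Data.Rational.Base as ℚ using (ℚ; _/_)
open import Data.Rational.Properties using (+-0-commutativeMonoid)
open import Algebra.Properties.CommutativeMonoid.Sum +-0-commutativeMonoid using (sum)

binom : ℕ → ℕ → ℚ
binom n k = + (n C k) / 1

catalan : ℕ → ℚ
catalan n = (+ 1 / suc n) ℚ.* binom (2 * n) n

-- The upper limit is inclusive.
sum≤ : ℕ → (ℕ → ℚ) → ℚ
sum≤ n f = sum {suc n} (λ i → f (toℕ i))

infixl 10 sum≤
syntax sum≤ n (λ k → e) = ∑[ k ≤ n ] e

{-# OPTIONS --safe #-}

-- Each sum telescopes by Gosper's method.  The summand is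
-- T k = p k * C(N, n-k) * C(M, n-k+s) / D with a polynomial p.  Write N = n+c and
-- M = n+s+e; for a suitable polynomial f the function
-- G k = (c+k) * (e+k) * f k * C(N, n-k) * C(M, n-k+s) / D
-- satisfies G k = T k + G (k+1) for k < n and G n = T n.  Hence the sum is G 0,
-- which is reduced to central binomial coefficients by the absorption identities.
module Submission where

open import Data.Integer.Base using (+_)
import Data.Integer.Base as ℤ
import Data.Integer.Properties as ℤ
open import Data.Nat.Base using (ℕ; zero; suc; _+_; _*_; _∸_; _^_; NonZero)
open import Data.Nat.Combinatorics using (_C_; nC1≡n; nCk+nC[k+1]≡[n+1]C[k+1])
open import Data.Nat.Properties
  using (+-cancelˡ-≡; +-comm; +-identityʳ; +-suc; *-identityʳ; *-assoc; *-comm;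
         *-distribʳ-+; m+n∸m≡n)
open import Data.Nat.Tactic.RingSolver using (solve-∀)
open import Data.Product.Base using (_×_; _,_)
open import Data.Rational.Base as ℚ using (ℚ; _/_)
import Data.Rational.Properties as ℚ
import Data.Rational.Unnormalised.Base as ℚᵘ
import Data.Rational.Unnormalised.Properties as ℚᵘ
open import Relation.Binary.PropositionalEquality
  using (_≡_; refl; sym; trans; cong; cong₂; module ≡-Reasoning)
open import Defs

open ≡-Reasoning

-- Fractions with natural numerators

-- `_/_` on `ℚ` reduces to lowest terms, so nothing can be read off from numerators and denominators
-- directly. The proofs about fractions therefore pass to unnormalised rationals, where equality is
-- cross multiplication. Matching denominators as `suc _` lets `_/_` unfold.
/-cross : ∀ a b c d .{{_ : NonZero b}} .{{_ : NonZero d}} →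
          a * d ≡ c * b → + a / b ≡ + c / d
/-cross a b@(suc _) c d@(suc _) eq = ℚ.fromℚᵘ-cong {+ a ℚᵘ./ b} {+ c ℚᵘ./ d} (ℚᵘ.*≡* (begin
  + a ℤ.* + d  ≡⟨ ℤ.pos-* a d ⟨
  + (a * d)    ≡⟨ cong +_ eq ⟩
  + (c * b)    ≡⟨ ℤ.pos-* c b ⟩
  + c ℤ.* + b  ∎))

/-*-/ : ∀ a b c d .{{_ : NonZero b}} .{{_ : NonZero d}} .{{_ : NonZero (b * d)}} →
        (+ a / b) ℚ.* (+ c / d) ≡ + (a * c) / (b * d)
/-*-/ a b@(suc _) c d@(suc _) = ℚ.toℚᵘ-injective (begin′
  ℚ.toℚᵘ ((+ a / b) ℚ.* (+ c / d))          ≈⟨ ℚ.toℚᵘ-homo-* (+ a / b) (+ c / d) ⟩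
  ℚ.toℚᵘ (+ a / b) ℚᵘ.* ℚ.toℚᵘ (+ c / d)    ≈⟨ ℚᵘ.*-cong (ℚ.toℚᵘ-fromℚᵘ (+ a ℚᵘ./ b))
                                                         (ℚ.toℚᵘ-fromℚᵘ (+ c ℚᵘ./ d)) ⟩
  (+ a ℚᵘ./ b) ℚᵘ.* (+ c ℚᵘ./ d)            ≈⟨ ℚᵘ.*≡* (cong (ℤ._* + (b * d)) (sym (ℤ.pos-* a c))) ⟩
  + (a * c) ℚᵘ./ (b * d)                    ≈⟨ ℚ.toℚᵘ-fromℚᵘ (+ (a * c) ℚᵘ./ (b * d)) ⟨
  ℚ.toℚᵘ (+ (a * c) / (b * d))              ∎′)
  where open ℚᵘ.≃-Reasoning using (step-≈-⟩; step-≈-⟨) renaming (begin_ to begin′_; _∎ to _∎′)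

/-+-/ : ∀ a c d .{{_ : NonZero d}} → (+ a / d) ℚ.+ (+ c / d) ≡ + (a + c) / d
/-+-/ a c d@(suc _) = ℚ.toℚᵘ-injective (begin′
  ℚ.toℚᵘ ((+ a / d) ℚ.+ (+ c / d))          ≈⟨ ℚ.toℚᵘ-homo-+ (+ a / d) (+ c / d) ⟩
  ℚ.toℚᵘ (+ a / d) ℚᵘ.+ ℚ.toℚᵘ (+ c / d)    ≈⟨ ℚᵘ.+-cong (ℚ.toℚᵘ-fromℚᵘ (+ a ℚᵘ./ d))
                                                         (ℚ.toℚᵘ-fromℚᵘ (+ c ℚᵘ./ d)) ⟩
  (+ a ℚᵘ./ d) ℚᵘ.+ (+ c ℚᵘ./ d)            ≈⟨ ℚᵘ.*≡* numerators ⟩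
  + (a + c) ℚᵘ./ d                          ≈⟨ ℚ.toℚᵘ-fromℚᵘ (+ (a + c) ℚᵘ./ d) ⟨
  ℚ.toℚᵘ (+ (a + c) / d)                    ∎′)
  where
  open ℚᵘ.≃-Reasoning using (step-≈-⟩; step-≈-⟨) renaming (begin_ to begin′_; _∎ to _∎′)
  -- Unnormalised addition always multiplies the denominators, so the sum arrives over `d * d` and a
  -- factor `d` has to be cancelled.
  numerators : (+ a ℤ.* + d ℤ.+ + c ℤ.* + d) ℤ.* + d ≡ + (a + c) ℤ.* + (d * d)
  numerators = begin
    (+ a ℤ.* + d ℤ.+ + c ℤ.* + d) ℤ.* + d  ≡⟨ cong (ℤ._* + d) (ℤ.*-distribʳ-+ (+ d) (+ a) (+ c)) ⟨
    + (a + c) ℤ.* + d ℤ.* + d              ≡⟨ ℤ.*-assoc (+ (a + c)) (+ d) (+ d) ⟩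
    + (a + c) ℤ.* (+ d ℤ.* + d)            ≡⟨ cong (+ (a + c) ℤ.*_) (ℤ.pos-* d d) ⟨
    + (a + c) ℤ.* + (d * d)                ∎

/-*-integer : ∀ a b c .{{_ : NonZero b}} → (+ a / b) ℚ.* (+ c / 1) ≡ + (a * c) / b
/-*-integer a b@(suc _) c = begin
  (+ a / b) ℚ.* (+ c / 1)  ≡⟨ /-*-/ a b c 1 ⟩
  + (a * c) / (b * 1)      ≡⟨ /-cross (a * c) (b * 1) (a * c) b (cong (a * c *_) (sym (*-identityʳ b))) ⟩
  + (a * c) / b            ∎

catalan≡ : ∀ n → catalan n ≡ + ((2 * n) C n) / suc n
catalan≡ n = begin
  catalan n                      ≡⟨ /-*-integer 1 (suc n) ((2 * n) C n) ⟩
  + (1 * ((2 * n) C n)) / suc n  ≡⟨ cong (λ x → + x / suc n) (+-identityʳ ((2 * n) C n)) ⟩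
  + ((2 * n) C n) / suc n        ∎

-- Absorption identities for binomial coefficients

-- Induction on `n` through Pascal's rule: after one copy of `a` is set aside, the two summands fall
-- under the induction hypotheses for `k` and `suc k`. A second use of Pascal's rule recombines them
-- into `suc n * a`, and the spare copy raises the factor to `2 + n`.
[1+k]*[1+n]C[1+k]≡[1+n]*nCk : ∀ n k → suc k * (suc n C suc k) ≡ suc n * (n C k)
[1+k]*[1+n]C[1+k]≡[1+n]*nCk n zero = begin
  1 * (suc n C 1)  ≡⟨ +-identityʳ _ ⟩
  suc n C 1        ≡⟨ nC1≡n (suc n) ⟩
  suc n            ≡⟨ *-identityʳ (suc n) ⟨
  suc n * 1        ∎
[1+k]*[1+n]C[1+k]≡[1+n]*nCk zero (suc k) = *-comm (suc (suc k)) 0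
[1+k]*[1+n]C[1+k]≡[1+n]*nCk (suc n) (suc k) = begin
  (2 + k) * ((2 + n) C (2 + k))                      ≡⟨ cong ((2 + k) *_) (nCk+nC[k+1]≡[n+1]C[k+1] (suc n) (suc k)) ⟨
  (2 + k) * (a + b)                                  ≡⟨ split k a b ⟩
  suc k * a + (2 + k) * b + a                        ≡⟨ cong (_+ a) (cong₂ _+_ ([1+k]*[1+n]C[1+k]≡[1+n]*nCk n k)
                                                                               ([1+k]*[1+n]C[1+k]≡[1+n]*nCk n (suc k))) ⟩
  suc n * (n C k) + suc n * (n C suc k) + a          ≡⟨ merge n (n C k) (n C suc k) a ⟩
  suc n * (n C k + n C suc k) + a                    ≡⟨ cong (λ x → suc n * x + a) (nCk+nC[k+1]≡[n+1]C[k+1] n k) ⟩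
  suc n * a + a                                      ≡⟨ +-comm (suc n * a) a ⟩
  (2 + n) * a                                        ∎
  where
  a b : ℕ
  a = suc n C suc k
  b = suc n C (2 + k)
  split : ∀ k a b → (2 + k) * (a + b) ≡ suc k * a + (2 + k) * b + a
  split = solve-∀
  merge : ∀ n x y a → suc n * x + suc n * y + a ≡ suc n * (x + y) + a
  merge = solve-∀

-- Pascal's rule times `suc k`, compared with the preceding absorption identity; the common term
-- `suc k * (n C k)` cancels. The difference of `n` and `k` enters as `d` to avoid truncated
-- subtraction.
[1+k]*nC[1+k]≡d*nCk : ∀ n k d → n ≡ k + d → suc k * (n C suc k) ≡ d * (n C k)
[1+k]*nC[1+k]≡d*nCk n k d refl = +-cancelˡ-≡ (suc k * x) _ _ (begin
  suc k * x + suc k * (n C suc k)  ≡⟨ factor k x (n C suc k) ⟩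
  suc k * (x + n C suc k)          ≡⟨ cong (suc k *_) (nCk+nC[k+1]≡[n+1]C[k+1] n k) ⟩
  suc k * (suc n C suc k)          ≡⟨ [1+k]*[1+n]C[1+k]≡[1+n]*nCk n k ⟩
  suc (k + d) * x                  ≡⟨ *-distribʳ-+ x (suc k) d ⟩
  suc k * x + d * x                ∎)
  where
  x : ℕ
  x = n C k
  factor : ∀ k x y → suc k * x + suc k * y ≡ suc k * (x + y)
  factor = solve-∀

-- Both sides equal `suc k * (suc n C suc k)`, by the two absorption identities above.
[1+d]*[1+n]Ck≡[1+n]*nCk : ∀ n k d → n ≡ k + d → suc d * (suc n C k) ≡ suc n * (n C k)
[1+d]*[1+n]Ck≡[1+n]*nCk n k d eq = begin
  suc d * (suc n C k)      ≡⟨ [1+k]*nC[1+k]≡d*nCk (suc n) k (suc d) (trans (cong suc eq) (sym (+-suc k d))) ⟨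
  suc k * (suc n C suc k)  ≡⟨ [1+k]*[1+n]C[1+k]≡[1+n]*nCk n k ⟩
  suc n * (n C k)          ∎

[2+d]*[1+d]*[2+n]Ck≡[2+n]*[1+n]*nCk : ∀ n k d → n ≡ k + d →
  (2 + d) * (1 + d) * ((2 + n) C k) ≡ (2 + n) * (1 + n) * (n C k)
[2+d]*[1+d]*[2+n]Ck≡[2+n]*[1+n]*nCk n k d eq = begin
  (2 + d) * (1 + d) * ((2 + n) C k)    ≡⟨ swap (2 + d) (1 + d) _ ⟩
  (1 + d) * ((2 + d) * ((2 + n) C k))  ≡⟨ cong ((1 + d) *_) ([1+d]*[1+n]Ck≡[1+n]*nCk (1 + n) k (1 + d)
                                            (trans (cong suc eq) (sym (+-suc k d)))) ⟩
  (1 + d) * ((2 + n) * ((1 + n) C k))  ≡⟨ swap (2 + n) (1 + d) _ ⟨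
  (2 + n) * (1 + d) * ((1 + n) C k)    ≡⟨ *-assoc (2 + n) (1 + d) _ ⟩
  (2 + n) * ((1 + d) * ((1 + n) C k))  ≡⟨ cong ((2 + n) *_) ([1+d]*[1+n]Ck≡[1+n]*nCk n k d eq) ⟩
  (2 + n) * ((1 + n) * (n C k))        ≡⟨ *-assoc (2 + n) (1 + n) _ ⟨
  (2 + n) * (1 + n) * (n C k)          ∎
  where
  swap : ∀ x y z → x * y * z ≡ y * (x * z)
  swap = solve-∀

[2n+2]Cn : ∀ n → (n + 2) * (n + 1) * ((2 * n + 2) C n) ≡ (2 * n + 2) * (2 * n + 1) * ((2 * n) C n)
[2n+2]Cn n = begin
  (n + 2) * (n + 1) * ((2 * n + 2) C n)          ≡⟨ cong₂ _*_ (cong₂ _*_ (+-comm n 2) (+-comm n 1)) (cong (_C n) (+-comm (2 * n) 2)) ⟩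
  (2 + n) * (1 + n) * ((2 + 2 * n) C n)          ≡⟨ [2+d]*[1+d]*[2+n]Ck≡[2+n]*[1+n]*nCk (2 * n) n n (cong (λ x → n + x) (+-identityʳ n)) ⟩
  (2 + 2 * n) * (1 + 2 * n) * ((2 * n) C n)      ≡⟨ cong (_* ((2 * n) C n)) (cong₂ _*_ (+-comm 2 (2 * n)) (+-comm 1 (2 * n))) ⟩
  (2 * n + 2) * (2 * n + 1) * ((2 * n) C n)      ∎

-- Boundary binomials in terms of central ones

module _ (n : ℕ) where

  private
    X Y : ℕ
    X = (2 * (n + 1)) C (n + 1)
    Y = (2 * (n + 2)) C (n + 2)

  -- The path to the central coefficient goes through `(2 * (n + 1)) C n`: first the upper index
  -- drops by one, then the lower index rises by one.
  [2n+3]Cn : (n + 3) * (n + 2) * ((2 * n + 3) C n) ≡ (2 * n + 3) * (n + 1) * X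
  [2n+3]Cn = begin
    (n + 3) * (n + 2) * ((2 * n + 3) C n)          ≡⟨ cong ((n + 3) * (n + 2) *_) (cong (_C n) (index n)) ⟩
    (n + 3) * (n + 2) * (suc (2 * (n + 1)) C n)    ≡⟨ shuffle₁ n (suc (2 * (n + 1)) C n) ⟩
    (n + 2) * (suc (n + 2) * (suc (2 * (n + 1)) C n))
      ≡⟨ cong ((n + 2) *_) ([1+d]*[1+n]Ck≡[1+n]*nCk (2 * (n + 1)) n (n + 2) (double n)) ⟩
    (n + 2) * (suc (2 * (n + 1)) * ((2 * (n + 1)) C n))
      ≡⟨ shuffle₂ n ((2 * (n + 1)) C n) ⟩
    (2 * n + 3) * ((n + 2) * ((2 * (n + 1)) C n))
      ≡⟨ cong ((2 * n + 3) *_) ([1+k]*nC[1+k]≡d*nCk (2 * (n + 1)) n (n + 2) (double n)) ⟨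
    (2 * n + 3) * (suc n * ((2 * (n + 1)) C suc n))
      ≡⟨ cong (λ m → (2 * n + 3) * (m * ((2 * (n + 1)) C m))) (+-comm 1 n) ⟩
    (2 * n + 3) * ((n + 1) * X)                    ≡⟨ *-assoc (2 * n + 3) (n + 1) X ⟨
    (2 * n + 3) * (n + 1) * X                      ∎
    where
    index : ∀ n → 2 * n + 3 ≡ suc (2 * (n + 1))
    index = solve-∀
    double : ∀ n → 2 * (n + 1) ≡ n + (n + 2)
    double = solve-∀
    shuffle₁ : ∀ n x → (n + 3) * (n + 2) * x ≡ (n + 2) * (suc (n + 2) * x)
    shuffle₁ = solve-∀
    shuffle₂ : ∀ n x → (n + 2) * (suc (2 * (n + 1)) * x) ≡ (2 * n + 3) * ((n + 2) * x)
    shuffle₂ = solve-∀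

  [2n+4]C[n+1] : (n + 3) * (n + 2) * ((2 * n + 4) C (n + 1)) ≡ (2 * n + 4) * (2 * n + 3) * X
  [2n+4]C[n+1] = begin
    (n + 3) * (n + 2) * ((2 * n + 4) C (n + 1))
      ≡⟨ cong₂ _*_ (shiftₗ n) (cong (_C (n + 1)) (index n)) ⟩
    (n + 1 + 2) * (n + 1 + 1) * ((2 * (n + 1) + 2) C (n + 1))  ≡⟨ [2n+2]Cn (n + 1) ⟩
    (2 * (n + 1) + 2) * (2 * (n + 1) + 1) * X                  ≡⟨ cong (_* X) (shiftᵣ n) ⟩
    (2 * n + 4) * (2 * n + 3) * X                              ∎
    where
    index : ∀ n → 2 * n + 4 ≡ 2 * (n + 1) + 2
    index = solve-∀
    shiftₗ : ∀ n → (n + 3) * (n + 2) ≡ (n + 1 + 2) * (n + 1 + 1)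
    shiftₗ = solve-∀
    shiftᵣ : ∀ n → (2 * (n + 1) + 2) * (2 * (n + 1) + 1) ≡ (2 * n + 4) * (2 * n + 3)
    shiftᵣ = solve-∀

  [2n+6]C[n+2] : (n + 4) * (n + 3) * ((2 * n + 6) C (n + 2)) ≡ (2 * n + 6) * (2 * n + 5) * Y
  [2n+6]C[n+2] = begin
    (n + 4) * (n + 3) * ((2 * n + 6) C (n + 2))
      ≡⟨ cong₂ _*_ (shiftₗ n) (cong (_C (n + 2)) (index n)) ⟩
    (n + 2 + 2) * (n + 2 + 1) * ((2 * (n + 2) + 2) C (n + 2))  ≡⟨ [2n+2]Cn (n + 2) ⟩
    (2 * (n + 2) + 2) * (2 * (n + 2) + 1) * Y                  ≡⟨ cong (_* Y) (shiftᵣ n) ⟩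
    (2 * n + 6) * (2 * n + 5) * Y                              ∎
    where
    index : ∀ n → 2 * n + 6 ≡ 2 * (n + 2) + 2
    index = solve-∀
    shiftₗ : ∀ n → (n + 4) * (n + 3) ≡ (n + 2 + 2) * (n + 2 + 1)
    shiftₗ = solve-∀
    shiftᵣ : ∀ n → (2 * (n + 2) + 2) * (2 * (n + 2) + 1) ≡ (2 * n + 6) * (2 * n + 5)
    shiftᵣ = solve-∀

  [2n+4]Cn : (n + 4) * ((2 * n + 4) C n) ≡ (n + 1) * ((2 * n + 4) C (n + 1))
  [2n+4]Cn = begin
    (n + 4) * ((2 * n + 4) C n)        ≡⟨ [1+k]*nC[1+k]≡d*nCk (2 * n + 4) n (n + 4) (split n) ⟨
    suc n * ((2 * n + 4) C suc n)      ≡⟨ cong (λ m → m * ((2 * n + 4) C m)) (+-comm 1 n) ⟩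
    (n + 1) * ((2 * n + 4) C (n + 1))  ∎
    where
    split : ∀ n → 2 * n + 4 ≡ n + (n + 4)
    split = solve-∀

  [2n+6]C[n+1] : (n + 5) * ((2 * n + 6) C (n + 1)) ≡ (n + 2) * ((2 * n + 6) C (n + 2))
  [2n+6]C[n+1] = begin
    (n + 5) * ((2 * n + 6) C (n + 1))          ≡⟨ [1+k]*nC[1+k]≡d*nCk (2 * n + 6) (n + 1) (n + 5) (split n) ⟨
    suc (n + 1) * ((2 * n + 6) C suc (n + 1))  ≡⟨ cong (λ m → m * ((2 * n + 6) C m)) (sym (+-suc n 1)) ⟩
    (n + 2) * ((2 * n + 6) C (n + 2))          ∎
    where
    split : ∀ n → 2 * n + 6 ≡ n + 1 + (n + 5)
    split = solve-∀

-- Telescoping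

-- The step is required only below `n`, written as `k + suc d ≡ n`. The condition `g n ≡ t n` closes
-- the sum at its inclusive upper end, so no value of `g` beyond `n` has to vanish.
sum≤-telescope : ∀ n (t g : ℕ → ℚ) →
                 (∀ k d → k + suc d ≡ n → g k ≡ t k ℚ.+ g (suc k)) → g n ≡ t n →
                 sum≤ n t ≡ g 0
sum≤-telescope zero    t g step last = trans (ℚ.+-identityʳ (t 0)) (sym last)
sum≤-telescope (suc n) t g step last = begin
  t 0 ℚ.+ sum≤ n (λ k → t (suc k))  ≡⟨ cong (t 0 ℚ.+_) (sum≤-telescope n (λ k → t (suc k)) (λ k → g (suc k))
                                         (λ k d eq → step (suc k) d (cong suc eq)) last) ⟩
  t 0 ℚ.+ g 1                       ≡⟨ step 0 n refl ⟨
  g 0                               ∎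

sum≤-cong : ∀ n {t u : ℕ → ℚ} → (∀ k → t k ≡ u k) → sum≤ n t ≡ sum≤ n u
sum≤-cong zero    eq = cong (ℚ._+ ℚ.0ℚ) (eq 0)
sum≤-cong (suc n) eq = cong₂ ℚ._+_ (eq 0) (sum≤-cong n (λ k → eq (suc k)))

-- With `d = n - k`, the complements of the lower indices `d` and `d + s` in `N` and `M` are `c + k`
-- and `e + k`. Absorption rewrites `G (suc k)` as `d * (d + s) * f (suc k)` times the binomials of
-- index `k`; dividing these out of `G k ≡ T k + G (suc k)` leaves `certificate`, a polynomial
-- identity.
module _ (n s : ℕ) {c e N M : ℕ} (N≡ : N ≡ n + c) (M≡ : M ≡ n + s + e)
         (D : ℕ) .{{_ : NonZero D}} (p f : ℕ → ℕ)
         (certificate : ∀ k d → k + d ≡ n →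
                        p k + d * (d + s) * f (suc k) ≡ (c + k) * (e + k) * f k) where

  private
    T G : ℕ → ℕ
    T k = p k * (N C (n ∸ k)) * (M C (n ∸ k + s))
    G k = (c + k) * (e + k) * f k * (N C (n ∸ k)) * (M C (n ∸ k + s))

    n∸k≡ : ∀ {k} d → k + d ≡ n → n ∸ k ≡ d
    n∸k≡ {k} d refl = m+n∸m≡n k d

    G-step : ∀ k d → k + suc d ≡ n → G k ≡ T k + G (suc k)
    G-step k d eq
      -- This turns the lower indices at `k` into successors of those at `suc k`, the form that
      -- absorption needs.
      rewrite n∸k≡ (suc d) eq | n∸k≡ {suc k} d (trans (sym (+-suc k d)) eq) = begin
      (c + k) * (e + k) * f k * A * B                          ≡⟨ cong (λ x → x * A * B) (certificate k (suc d) eq) ⟨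
      (p k + suc d * suc (d + s) * f′) * A * B                 ≡⟨ expand (p k) (suc d) (suc (d + s)) f′ A B ⟩
      p k * A * B + f′ * (suc d * A) * (suc (d + s) * B)       ≡⟨ cong₂ (λ x y → p k * A * B + f′ * x * y)
                                                                   ([1+k]*nC[1+k]≡d*nCk N d (c + suc k) N≡d)
                                                                   ([1+k]*nC[1+k]≡d*nCk M (d + s) (e + suc k) M≡d) ⟩
      p k * A * B + f′ * ((c + suc k) * A′) * ((e + suc k) * B′)
                                                               ≡⟨ cong (_+_ (p k * A * B)) (collect (c + suc k) (e + suc k) f′ A′ B′) ⟩
      p k * A * B + (c + suc k) * (e + suc k) * f′ * A′ * B′   ∎
      where
      f′ A B A′ B′ : ℕ
      f′ = f (suc k)
      A  = N C suc d
      B  = M C suc (d + s)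
      A′ = N C d
      B′ = M C (d + s)
      expand : ∀ p u v f a b → (p + u * v * f) * a * b ≡ p * a * b + f * (u * a) * (v * b)
      expand = solve-∀
      collect : ∀ u v f a b → f * (u * a) * (v * b) ≡ u * v * f * a * b
      collect = solve-∀
      shift : ∀ k d s e → k + suc d + s + e ≡ d + s + (e + suc k)
      shift = solve-∀
      shift₀ : ∀ k d c → k + suc d + c ≡ d + (c + suc k)
      shift₀ = solve-∀
      N≡d : N ≡ d + (c + suc k)
      N≡d = trans N≡ (trans (cong (_+ c) (sym eq)) (shift₀ k d c))
      M≡d : M ≡ d + s + (e + suc k)
      M≡d = trans M≡ (trans (cong (λ x → x + s + e) (sym eq)) (shift k d s e))

    G-last : G n ≡ T n
    G-last = cong (λ x → x * (N C (n ∸ n)) * (M C (n ∸ n + s)))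
                  -- At `d = 0` the term with `f (suc n)` vanishes, so the certificate also yields
                  -- the end condition.
                  (sym (trans (sym (+-identityʳ (p n))) (certificate n 0 (+-identityʳ n))))

  sum≤-Gosper : sum≤ n (λ k → (+ p k / D) ℚ.* binom N (n ∸ k) ℚ.* binom M (n ∸ k + s)) ≡
                + (c * e * f 0 * (N C n) * (M C (n + s))) / D
  sum≤-Gosper = begin
    sum≤ n (λ k → (+ p k / D) ℚ.* binom N (n ∸ k) ℚ.* binom M (n ∸ k + s))
      ≡⟨ sum≤-cong n (λ k → trans (cong (ℚ._* binom M (n ∸ k + s)) (/-*-integer (p k) D (N C (n ∸ k))))
                                  (/-*-integer (p k * (N C (n ∸ k))) D (M C (n ∸ k + s)))) ⟩
    sum≤ n (λ k → + T k / D)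
      ≡⟨ sum≤-telescope n (λ k → + T k / D) (λ k → + G k / D)
           (λ k d eq → trans (cong (λ x → + x / D) (G-step k d eq)) (sym (/-+-/ (T k) (G (suc k)) D)))
           (cong (λ x → + x / D) G-last) ⟩
    + G 0 / D
      ≡⟨ cong₂ (λ u v → + (u * v * f 0 * (N C n) * (M C (n + s))) / D) (+-identityʳ c) (+-identityʳ e) ⟩
    + (c * e * f 0 * (N C n) * (M C (n + s))) / D ∎

catalan-*-catalan : ∀ m n x D .{{_ : NonZero D}} →
  ((2 * m) C m) * ((2 * n) C n) * D ≡ x * (suc m * suc n) →
  catalan m ℚ.* catalan n ≡ + x / D
catalan-*-catalan m n x D eq = begin
  catalan m ℚ.* catalan n                                ≡⟨ cong₂ ℚ._*_ (catalan≡ m) (catalan≡ n) ⟩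
  (+ ((2 * m) C m) / suc m) ℚ.* (+ ((2 * n) C n) / suc n)  ≡⟨ /-*-/ ((2 * m) C m) (suc m) ((2 * n) C n) (suc n) ⟩
  + (((2 * m) C m) * ((2 * n) C n)) / (suc m * suc n)     ≡⟨ /-cross (((2 * m) C m) * ((2 * n) C n)) (suc m * suc n) x D eq ⟩
  + x / D                                                ∎

-- The three certificates and their values at `k = 0`

module _ (n : ℕ) where

  private
    D₁ D₂ X Y : ℕ
    D₁ = (2 + 2 * n) * (3 + 2 * n) * (4 + 2 * n) * (5 + 2 * n) * (6 + 2 * n)
    D₂ = (2 + 2 * n) * (3 + 2 * n) * (4 + 2 * n) ^ 2
    X = (2 * (n + 1)) C (n + 1)
    Y = (2 * (n + 2)) C (n + 2)

    -- Each `f` is a solution, quadratic in `k`, of the certificate equation for its cubic `p`; for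
    -- `f₂` the cubic is `(3 + 2 * n) * p₂ k`. At `k = 0` they compute to `4 * (n + 2)`,
    -- `2 * (n + 3)` and `4 * (n + 4)`, the constants in the `collect` identities.
    p₁ f₁ p₂ f₂ p₃ f₃ : ℕ → ℕ
    p₁ k = (2 * k + 2) * (2 * k + 4) * (8 * n * k + 6 * n + 14 * k + 12)
    f₁ k = 4 * (2 * k * k + 3 * k + n + 2)
    p₂ k = (2 * k + 2) * (2 * k + 3) * (2 * k + 4)
    f₂ k = 2 * (2 * k * k + 4 * k + n + 3)
    p₃ k = (2 * k + 2) * (2 * k + 4) * (8 * n * k + 18 * n + 14 * k + 30)
    f₃ k = 4 * (2 * k * k + 5 * k + n + 4)

  catalan-sum₁ : catalan (n + 1) ℚ.* catalan (n + 2) ≡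
       ∑[ k ≤ n ] ((+ p₁ k / D₁) ℚ.* binom (2 * n + 3) (n ∸ k) ℚ.* binom (2 * n + 6) (n ∸ k + 2))
  catalan-sum₁ = trans
    (catalan-*-catalan (n + 1) (n + 2) ((n + 3) * (n + 4) * f₁ 0 * A * B) D₁ (begin
      -- Since `(2 + 2 * n) * (4 + 2 * n)` is `4 * (n + 1) * (n + 2)`, the factors of `D₁` supply
      -- exactly what `X` and `Y` need to become `A` and `B`, with `4 * (n + 2)` left over.
      X * Y * D₁  ≡⟨ expand n X Y ⟩
      4 * (n + 2) * ((2 * n + 3) * (n + 1) * X) * ((2 * n + 6) * (2 * n + 5) * Y)
                  ≡⟨ cong₂ (λ x y → 4 * (n + 2) * x * y) ([2n+3]Cn n) ([2n+6]C[n+2] n) ⟨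
      4 * (n + 2) * ((n + 3) * (n + 2) * A) * ((n + 4) * (n + 3) * B)
                  ≡⟨ collect n A B ⟩
      (n + 3) * (n + 4) * f₁ 0 * A * B * (suc (n + 1) * suc (n + 2)) ∎))
    (sym (sum≤-Gosper n 2 (N≡ n) (M≡ n) D₁ p₁ f₁ certificate))
    where
    A B : ℕ
    A = (2 * n + 3) C n
    B = (2 * n + 6) C (n + 2)
    N≡ : ∀ n → 2 * n + 3 ≡ n + (n + 3)
    N≡ = solve-∀
    M≡ : ∀ n → 2 * n + 6 ≡ n + 2 + (n + 4)
    M≡ = solve-∀
    expand : ∀ n x y →
      x * y * ((2 + 2 * n) * (3 + 2 * n) * (4 + 2 * n) * (5 + 2 * n) * (6 + 2 * n)) ≡
      4 * (n + 2) * ((2 * n + 3) * (n + 1) * x) * ((2 * n + 6) * (2 * n + 5) * y)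
    expand = solve-∀
    collect : ∀ n a b →
      4 * (n + 2) * ((n + 3) * (n + 2) * a) * ((n + 4) * (n + 3) * b) ≡
      (n + 3) * (n + 4) * (4 * (n + 2)) * a * b * (suc (n + 1) * suc (n + 2))
    collect = solve-∀
    identity : ∀ k d →
      (2 * k + 2) * (2 * k + 4) * (8 * (k + d) * k + 6 * (k + d) + 14 * k + 12)
        + d * (d + 2) * (4 * (2 * suc k * suc k + 3 * suc k + (k + d) + 2)) ≡
      (k + d + 3 + k) * (k + d + 4 + k) * (4 * (2 * k * k + 3 * k + (k + d) + 2))
    identity = solve-∀
    certificate : ∀ k d → k + d ≡ n →
      p₁ k + d * (d + 2) * f₁ (suc k) ≡ (n + 3 + k) * (n + 4 + k) * f₁ k
    -- Matching on `refl` replaces `n` by `k + d`, leaving a subtraction-free identity for the ring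
    -- solver.
    certificate k d refl = identity k d

  -- The Gosper polynomial of the second sum has denominator 3 + 2 n, so the
  -- summand is scaled by 3 + 2 n to keep the certificate over ℕ.
  catalan-sum₂ : catalan (n + 1) ℚ.* catalan (n + 1) ≡
       ∑[ k ≤ n ] ((+ p₂ k / D₂) ℚ.* binom (2 * n + 4) (n ∸ k) ℚ.* binom (2 * n + 4) (n ∸ k + 1))
  catalan-sum₂ = begin
    catalan (n + 1) ℚ.* catalan (n + 1)
      ≡⟨ catalan-*-catalan (n + 1) (n + 1) ((n + 4) * (n + 3) * f₂ 0 * A * B) ((3 + 2 * n) * D₂) (begin
        X * X * ((3 + 2 * n) * D₂)  ≡⟨ expand n X ⟩
        2 * (n + 1) * ((2 * n + 4) * (2 * n + 3) * X) * ((2 * n + 4) * (2 * n + 3) * X)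
                                    ≡⟨ cong (λ x → 2 * (n + 1) * x * x) ([2n+4]C[n+1] n) ⟨
        2 * (n + 1) * ((n + 3) * (n + 2) * B) * ((n + 3) * (n + 2) * B)
                                    ≡⟨ regroup n B ⟩
        -- Both copies of `X` have become `B`; the spare factor `n + 1` moves one of them to the
        -- neighbouring coefficient `A`.
        2 * ((n + 1) * B) * ((n + 3) * (n + 2) * ((n + 3) * (n + 2) * B))
                                    ≡⟨ cong (λ x → 2 * x * ((n + 3) * (n + 2) * ((n + 3) * (n + 2) * B))) ([2n+4]Cn n) ⟨
        2 * ((n + 4) * A) * ((n + 3) * (n + 2) * ((n + 3) * (n + 2) * B))
                                    ≡⟨ collect n A B ⟩
        (n + 4) * (n + 3) * f₂ 0 * A * B * (suc (n + 1) * suc (n + 1)) ∎) ⟩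
    + ((n + 4) * (n + 3) * f₂ 0 * A * B) / ((3 + 2 * n) * D₂)
      ≡⟨ sum≤-Gosper n 1 (N≡ n) (M≡ n) ((3 + 2 * n) * D₂) (λ k → (3 + 2 * n) * p₂ k) f₂ certificate ⟨
    ∑[ k ≤ n ] ((+ ((3 + 2 * n) * p₂ k) / ((3 + 2 * n) * D₂)) ℚ.* binom (2 * n + 4) (n ∸ k) ℚ.* binom (2 * n + 4) (n ∸ k + 1))
      ≡⟨ sum≤-cong n (λ k → cong (λ x → x ℚ.* binom (2 * n + 4) (n ∸ k) ℚ.* binom (2 * n + 4) (n ∸ k + 1))
           (/-cross ((3 + 2 * n) * p₂ k) ((3 + 2 * n) * D₂) (p₂ k) D₂ (swap (3 + 2 * n) (p₂ k) D₂))) ⟩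
    ∑[ k ≤ n ] ((+ p₂ k / D₂) ℚ.* binom (2 * n + 4) (n ∸ k) ℚ.* binom (2 * n + 4) (n ∸ k + 1)) ∎
    where
    A B : ℕ
    A = (2 * n + 4) C n
    B = (2 * n + 4) C (n + 1)
    N≡ : ∀ n → 2 * n + 4 ≡ n + (n + 4)
    N≡ = solve-∀
    M≡ : ∀ n → 2 * n + 4 ≡ n + 1 + (n + 3)
    M≡ = solve-∀
    swap : ∀ x y z → x * y * z ≡ y * (x * z)
    swap = solve-∀
    expand : ∀ n x →
      -- The trailing `* 1` is the unfolded form of the square in `D₂`.
      x * x * ((3 + 2 * n) * ((2 + 2 * n) * (3 + 2 * n) * ((4 + 2 * n) * ((4 + 2 * n) * 1)))) ≡
      2 * (n + 1) * ((2 * n + 4) * (2 * n + 3) * x) * ((2 * n + 4) * (2 * n + 3) * x)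
    expand = solve-∀
    regroup : ∀ n b →
      2 * (n + 1) * ((n + 3) * (n + 2) * b) * ((n + 3) * (n + 2) * b) ≡
      2 * ((n + 1) * b) * ((n + 3) * (n + 2) * ((n + 3) * (n + 2) * b))
    regroup = solve-∀
    collect : ∀ n a b →
      2 * ((n + 4) * a) * ((n + 3) * (n + 2) * ((n + 3) * (n + 2) * b)) ≡
      (n + 4) * (n + 3) * (2 * (n + 3)) * a * b * (suc (n + 1) * suc (n + 1))
    collect = solve-∀
    identity : ∀ k d →
      (3 + 2 * (k + d)) * ((2 * k + 2) * (2 * k + 3) * (2 * k + 4))
        + d * (d + 1) * (2 * (2 * suc k * suc k + 4 * suc k + (k + d) + 3)) ≡
      (k + d + 4 + k) * (k + d + 3 + k) * (2 * (2 * k * k + 4 * k + (k + d) + 3))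
    identity = solve-∀
    certificate : ∀ k d → k + d ≡ n →
      (3 + 2 * n) * p₂ k + d * (d + 1) * f₂ (suc k) ≡ (n + 4 + k) * (n + 3 + k) * f₂ k
    certificate k d refl = identity k d

  catalan-sum₃ : catalan (n + 1) ℚ.* catalan (n + 2) ≡
       ∑[ k ≤ n ] ((+ p₃ k / D₁) ℚ.* binom (2 * n + 3) (n ∸ k) ℚ.* binom (2 * n + 6) (n ∸ k + 1))
  catalan-sum₃ = trans
    (catalan-*-catalan (n + 1) (n + 2) ((n + 3) * (n + 5) * f₃ 0 * A * B) D₁ (begin
      X * Y * D₁  ≡⟨ expand n X Y ⟩
      4 * (n + 2) * ((2 * n + 3) * (n + 1) * X) * ((2 * n + 6) * (2 * n + 5) * Y)
                  ≡⟨ cong₂ (λ x y → 4 * (n + 2) * x * y) ([2n+3]Cn n) ([2n+6]C[n+2] n) ⟨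
      4 * (n + 2) * ((n + 3) * (n + 2) * A) * ((n + 4) * (n + 3) * B′)
                  ≡⟨ regroup n A B′ ⟩
      -- With shift `1` the boundary term contains `B`, not `B′`. The leftover `n + 2` trades one
      -- for the other and produces the factor `n + 5`, while `n + 4` goes into `f₃ 0`.
      4 * ((n + 3) * (n + 2) * A) * ((n + 4) * (n + 3) * ((n + 2) * B′))
                  ≡⟨ cong (λ x → 4 * ((n + 3) * (n + 2) * A) * ((n + 4) * (n + 3) * x)) ([2n+6]C[n+1] n) ⟨
      4 * ((n + 3) * (n + 2) * A) * ((n + 4) * (n + 3) * ((n + 5) * B))
                  ≡⟨ collect n A B ⟩
      (n + 3) * (n + 5) * f₃ 0 * A * B * (suc (n + 1) * suc (n + 2)) ∎))
    (sym (sum≤-Gosper n 1 (N≡ n) (M≡ n) D₁ p₃ f₃ certificate))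
    where
    A B B′ : ℕ
    A = (2 * n + 3) C n
    B = (2 * n + 6) C (n + 1)
    B′ = (2 * n + 6) C (n + 2)
    N≡ : ∀ n → 2 * n + 3 ≡ n + (n + 3)
    N≡ = solve-∀
    M≡ : ∀ n → 2 * n + 6 ≡ n + 1 + (n + 5)
    M≡ = solve-∀
    expand : ∀ n x y →
      x * y * ((2 + 2 * n) * (3 + 2 * n) * (4 + 2 * n) * (5 + 2 * n) * (6 + 2 * n)) ≡
      4 * (n + 2) * ((2 * n + 3) * (n + 1) * x) * ((2 * n + 6) * (2 * n + 5) * y)
    expand = solve-∀
    regroup : ∀ n a b →
      4 * (n + 2) * ((n + 3) * (n + 2) * a) * ((n + 4) * (n + 3) * b) ≡
      4 * ((n + 3) * (n + 2) * a) * ((n + 4) * (n + 3) * ((n + 2) * b))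
    regroup = solve-∀
    collect : ∀ n a b →
      4 * ((n + 3) * (n + 2) * a) * ((n + 4) * (n + 3) * ((n + 5) * b)) ≡
      (n + 3) * (n + 5) * (4 * (n + 4)) * a * b * (suc (n + 1) * suc (n + 2))
    collect = solve-∀
    identity : ∀ k d →
      (2 * k + 2) * (2 * k + 4) * (8 * (k + d) * k + 18 * (k + d) + 14 * k + 30)
        + d * (d + 1) * (4 * (2 * suc k * suc k + 5 * suc k + (k + d) + 4)) ≡
      (k + d + 3 + k) * (k + d + 5 + k) * (4 * (2 * k * k + 5 * k + (k + d) + 4))
    identity = solve-∀
    certificate : ∀ k d → k + d ≡ n →
      p₃ k + d * (d + 1) * f₃ (suc k) ≡ (n + 3 + k) * (n + 5 + k) * f₃ k
    certificate k d refl = identity k d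

corollary3p5 : (n : ℕ) →
    (catalan (n + 1) ℚ.* catalan (n + 2) ≡
    ∑[ k ≤ n ] (
    (+ ((2 * k + 2) * (2 * k + 4) * (8 * n * k + 6 * n + 14 * k + 12))
    / ((2 + 2 * n) * (3 + 2 * n) * (4 + 2 * n) * (5 + 2 * n) * (6 + 2 * n)))
    ℚ.* binom (2 * n + 3) (n ∸ k) ℚ.* binom (2 * n + 6) (n ∸ k + 2)))
    ×
    (catalan (n + 1) ℚ.* catalan (n + 1) ≡
    ∑[ k ≤ n ] (
    (+ ((2 * k + 2) * (2 * k + 3) * (2 * k + 4))
    / ((2 + 2 * n) * (3 + 2 * n) * (4 + 2 * n) ^ 2))
    ℚ.* binom (2 * n + 4) (n ∸ k) ℚ.* binom (2 * n + 4) (n ∸ k + 1)))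
    ×
    (catalan (n + 1) ℚ.* catalan (n + 2) ≡
    ∑[ k ≤ n ] (
    (+ ((2 * k + 2) * (2 * k + 4) * (8 * n * k + 18 * n + 14 * k + 30))
    / ((2 + 2 * n) * (3 + 2 * n) * (4 + 2 * n) * (5 + 2 * n) * (6 + 2 * n)))
    ℚ.* binom (2 * n + 3) (n ∸ k) ℚ.* binom (2 * n + 6) (n ∸ k + 1)))
corollary3p5 n = catalan-sum₁ n , catalan-sum₂ n , catalan-sum₃ n
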